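{- Let $G$ be an oriented hypergraph, with $2$-section $[G]_2$ and strict $2$-section $\llbracket G\rrbracket_2$. Then their adjacency matrices coincide: $A(G)=A(\llbracket G\rrbracket_2)=A([G]_2)$.
   Context: A hypergraph $H=(V,E,\mathcal I)$ consists of a finite set $V=\{v_1,\dots,v_n\}$ of vertices, a finite family $E=(e_\iota)_{\iota\in\Omega}$ of subsets of $V$ (the edges; an edge may be empty, and edges with different indices are regarded as different even if they coincide as sets) and its incidences $\mathcal I$. All hypergraphs are simple: each vertex $v\in e$ is incident with $e$ exactly once, so $\mathcal I=\{(v,e): v\in e\}$. An oriented hypergraph is a pair $G=(H,\sigma)$ with $\sigma:\mathcal I\to\{+1,-1\}$. For an edge $e$ and distinct vertices $v_i,v_j\in e$, put $\mathrm{sgn}_e(v_i,v_j)=-\sigma(v_i,e)\sigma(v_j,e)$. The adjacency matrix $A(G)\in\mathbb R^{n\times n}$ has entries $a_{ij}=\sum_{e}\mathrm{sgn}_e(v_i,v_j)$ for $i\neq j$, the sum being over all edges $e$ containing both $v_i$ and $v_j$ (so $a_{ij}=0$ if there are none), and $a_{ii}=0$. The $2$-section $[G]_2$ is the oriented hypergraph with the same (identically ordered) vertex set as $G$ whose edges are: (1) sets $f\subseteq V$ with $|f|=2$ and $f\subseteq e$ for some $e\in E$, and (2) sets $f$ with $|f|<2$ and $f=e$ for some $e\in E$. The incidence signs of $f$ are carried over from $e$: $\sigma_{[G]_2}(v,f)=\sigma_G(v,e)$ for $v\in f$. The edges are taken with multiplicity: there is one edge $f$ for each pair $(e,f)$ with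 $e\in E$ and $f$ as in (1) or (2). The strict $2$-section $\llbracket G\rrbracket_2$ is defined in the same way but using only the edges of type (1). -}

module Defs where

open import Data.Bool.Properties using () renaming (_≟_ to _≟ᵇ_)
open import Data.Empty using (⊥)
open import Data.Fin using (Fin; _≟_)
open import Data.Fin.Subset using (Subset; inside; outside; _∈_; _⊆_; ∣_∣)
open import Data.Fin.Subset.Properties using (_∈?_; _⊆?_)
open import Data.Integer using (ℤ; 0ℤ; _+_; _◃_)
open import Data.Irrelevant using ([_])
open import Data.List as List using (List; []; _∷_; _++_; concatMap; filter; foldr)
open import Data.List.Membership.Propositional using () renaming (_∈_ to _∈ˡ_)
open import Data.List.Membership.Propositional.Properties
  using (∈-map⁺; ∈-map⁻; ∈-++⁺ˡ; ∈-++⁺ʳ; ∈-concatMap⁺; ∈-filter⁺)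
open import Data.List.Relation.Binary.Disjoint.Propositional using (Disjoint)
open import Data.List.Relation.Unary.All using ([])
import Data.List.Relation.Unary.All as All
import Data.List.Relation.Unary.All.Properties as All
open import Data.List.Relation.Unary.AllPairs using ([]; _∷_)
import Data.List.Relation.Unary.AllPairs as AllPairs
import Data.List.Relation.Unary.AllPairs.Properties as AllPairs
open import Data.List.Relation.Unary.Any using (here)
import Data.List.Relation.Unary.Any as Any
open import Data.List.Relation.Unary.Unique.Propositional using (Unique)
import Data.List.Relation.Unary.Unique.Propositional.Properties as Unique
open import Data.Nat using (ℕ; zero; suc; _<_; _<?_) renaming (_≟_ to _≟ⁿ_)
open import Data.Product using (Σ; _×_; _,_; proj₁; proj₂)
open import Data.Refinement using (Refinement; Refinement-syntax; value; _,_)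
open import Data.Sign using (Sign; opposite; _*_)
open import Data.Sum using (_⊎_; inj₁; inj₂)
open import Data.Vec using (Vec; []; _∷_; tabulate)
open import Data.Vec.Properties using (∷-injectiveʳ; ≡-dec)
open import Function using (_∘_)
open import Relation.Binary.PropositionalEquality using (_≡_; _≢_; refl; sym; cong; subst)
open import Relation.Nullary using (Dec; yes; no; recompute)
open import Relation.Nullary.Decidable using (_×-dec_; _⊎-dec_)
open import Relation.Unary using (Decidable)

record Finite (A : Set) : Set where
  field
    elements : List A
    unique   : Unique elements
    complete : ∀ a → a ∈ˡ elements

open Finite

-- `unique` and `complete` make the value independent of the enumeration.
∑ : {A : Set} → Finite A → (A → ℤ) → ℤ
∑ fin g = foldr _+_ 0ℤ (List.map g (elements fin))

Subset-finite : ∀ n → Finite (Subset n)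
Subset-finite zero = record
  { elements = [] ∷ []
  ; unique   = [] ∷ []
  ; complete = λ { [] → here refl }
  }
Subset-finite (suc n) = record
  { elements = List.map (outside ∷_) ss ++ List.map (inside ∷_) ss
  ; unique   = Unique.++⁺ (Unique.map⁺ ∷-injectiveʳ ss!) (Unique.map⁺ ∷-injectiveʳ ss!)
                 λ (p , q) → disjoint (∈-map⁻ _ p) (∈-map⁻ _ q)
  ; complete = λ
    { (outside ∷ s) → ∈-++⁺ˡ (∈-map⁺ _ (complete ih s))
    ; (inside  ∷ s) → ∈-++⁺ʳ _ (∈-map⁺ _ (complete ih s))
    }
  }
  where
  ih  = Subset-finite n
  ss  = elements ih
  ss! = unique ih
  disjoint : ∀ {v : Subset (suc n)} →
             Σ (Subset n) (λ s → s ∈ˡ ss × v ≡ outside ∷ s) →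
             Σ (Subset n) (λ s → s ∈ˡ ss × v ≡ inside ∷ s) → ⊥
  disjoint (_ , _ , refl) (_ , _ , ())

Σ-finite : {A : Set} {B : A → Set} → Finite A → (∀ a → Finite (B a)) → Finite (Σ A B)
Σ-finite {A} {B} finA finB = record
  { elements = concatMap fibre (elements finA)
  ; unique   = Unique.concat⁺
      (All.map⁺ (All.universal fibre-unique (elements finA)))
      (AllPairs.map⁺ (AllPairs.map fibres-disjoint (unique finA)))
  ; complete = λ (a , b) → ∈-concatMap⁺ fibre
      (Any.map (λ { refl → ∈-map⁺ _ (complete (finB a) b) }) (complete finA a))
  }
  where
  fibre : A → List (Σ A B)
  fibre a = List.map (a ,_) (elements (finB a))
  fibre-unique : ∀ a → Unique (fibre a)
  fibre-unique a = Unique.map⁺ (λ { refl → refl }) (unique (finB a))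
  fibre-base : ∀ {a b x} → x ∈ˡ fibre a → x ∈ˡ fibre b → a ≡ b
  fibre-base p q with ∈-map⁻ _ p | ∈-map⁻ _ q
  ... | _ , _ , refl | _ , _ , refl = refl
  fibres-disjoint : ∀ {a b} → a ≢ b → Disjoint (fibre a) (fibre b)
  fibres-disjoint a≢b (p , q) = a≢b (fibre-base p q)

Refinement-finite : {A : Set} {P : A → Set} → Finite A → Decidable P →
                    Finite [ a ∈ A ∣ P a ]
Refinement-finite {A} {P} finA P? = record
  { elements = refineList (elements finA)
  ; unique   = Unique.map⁻ {f = value}
      (subst Unique (sym (map-value (elements finA)))
        (Unique.filter⁺ P? (unique finA)))
  ; complete = complete′
  }
  where
  refineList : List A → List [ a ∈ A ∣ P a ]
  refineList []       = []
  refineList (a ∷ as) with P? a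
  ... | yes p = (a , [ p ]) ∷ refineList as
  ... | no  _ = refineList as
  map-value : ∀ as → List.map value (refineList as) ≡ filter P? as
  map-value []       = refl
  map-value (a ∷ as) with P? a
  ... | yes _ = cong (a ∷_) (map-value as)
  ... | no  _ = map-value as
  complete′ : ∀ x → x ∈ˡ refineList (elements finA)
  complete′ (a , [ p ])
    with ∈-map⁻ value (subst (a ∈ˡ_) (sym (map-value (elements finA)))
           (∈-filter⁺ P? (complete finA a) (recompute (P? a) p)))
  ... | _ , x∈ , refl = x∈

-- The vertices are the elements of Fin n. Edges are told apart by their
-- index in Ω, so distinct edges may coincide as sets. Being simple, a
-- hypergraph has its incidences determined by membership.
record Hypergraph (n : ℕ) : Set₁ where
  field
    Ω        : Set
    Ω-finite : Finite Ω
    edge     : Ω → Subset n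

-- The membership argument of σ is irrelevant because a vertex is
-- incident with an edge at most once.
record OrientedHypergraph (n : ℕ) : Set₁ where
  field
    hypergraph : Hypergraph n
  open Hypergraph hypergraph public
  field
    σ : (v : Fin n) (ι : Ω) → .(v ∈ edge ι) → Sign

private
  variable
    n : ℕ

module _ (G : OrientedHypergraph n) where
  open OrientedHypergraph G

  sgn : (ι : Ω) (i j : Fin n) → .(i ∈ edge ι) → .(j ∈ edge ι) → Sign
  sgn ι i j i∈e j∈e = opposite (σ i ι i∈e * σ j ι j∈e)

  EdgesContaining : Fin n → Fin n → Set
  EdgesContaining i j = [ ι ∈ Ω ∣ (i ∈ edge ι × j ∈ edge ι) ]

  EdgesContaining-finite : ∀ i j → Finite (EdgesContaining i j)
  EdgesContaining-finite i j =
    Refinement-finite Ω-finite λ ι → (i ∈? edge ι) ×-dec (j ∈? edge ι)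

  adjacencyEntry : Fin n → Fin n → ℤ
  adjacencyEntry i j with i ≟ j
  ... | yes _ = 0ℤ
  ... | no  _ = ∑ (EdgesContaining-finite i j)
                  λ (ι , [ ij∈e ]) → sgn ι i j (proj₁ ij∈e) (proj₂ ij∈e) ◃ 1

  -- All entries are integers, so ℤ replaces the real numbers.
  adjacencyMatrix : Vec (Vec ℤ n) n
  adjacencyMatrix = tabulate λ i → tabulate λ j → adjacencyEntry i j

PairIn : Subset n → Subset n → Set
PairIn e f = ∣ f ∣ ≡ 2 × f ⊆ e

SmallEdge : Subset n → Subset n → Set
SmallEdge e f = ∣ f ∣ < 2 × f ≡ e

PairIn? : (e : Subset n) → Decidable (PairIn e)
PairIn? e f = (∣ f ∣ ≟ⁿ 2) ×-dec (f ⊆? e)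

SmallEdge? : (e : Subset n) → Decidable (SmallEdge e)
SmallEdge? e f = (∣ f ∣ <? 2) ×-dec ≡-dec _≟ᵇ_ f e

-- One edge f for each pair of an edge e of G and a subset f of e with
-- P e f. The index set consists of these pairs, so that the same f
-- arising from different e is counted separately.
subedges : (P : Subset n → Subset n → Set) → (∀ e → Decidable (P e)) →
           (∀ {e f} → P e f → f ⊆ e) →
           OrientedHypergraph n → OrientedHypergraph n
subedges {n} P P? P⇒⊆ G = record
  { hypergraph = record
    { Ω        = Σ Ω λ ι → [ f ∈ Subset n ∣ P (edge ι) f ]
    ; Ω-finite = Σ-finite Ω-finite λ ι →
                   Refinement-finite (Subset-finite n) (P? (edge ι))
    ; edge     = λ (_ , f) → value f
    }
  ; σ = λ { v (ι , f , [ p ]) v∈f → σ v ι (P⇒⊆ p v∈f) }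
  }
  where open OrientedHypergraph G

strict2Section : OrientedHypergraph n → OrientedHypergraph n
strict2Section = subedges PairIn PairIn? proj₂

2Section : OrientedHypergraph n → OrientedHypergraph n
2Section = subedges
  (λ e f → PairIn e f ⊎ SmallEdge e f)
  (λ e f → PairIn? e f ⊎-dec SmallEdge? e f)
  λ { (inj₁ (_ , f⊆e)) → f⊆e ; (inj₂ (_ , refl)) → λ v∈f → v∈f }

{-# OPTIONS --safe #-}

-- For i ≠ j, the only set of at most two vertices that contains both i
-- and j is {i , j}. So the edges of either 2-section through i and j
-- correspond to the edges of G through i and j, one for each, with the
-- same signs, and the sums defining the adjacency entries agree term
-- by term.
module Submission where

open import Defs
open import Data.Bool.Properties using () renaming (_≟_ to _≟ᵇ_)
open import Data.Fin using (Fin; zero; suc; _≟_)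
open import Data.Fin.Subset using (Subset; inside; outside; _∈_; _∉_; _⊆_; _∪_; ⁅_⁆; ∣_∣)
open import Data.Fin.Subset.Properties
  using (_∈?_; ⊆-antisym; p⊂q⇒∣p∣<∣q∣; ∪-identityˡ; ∣⁅x⁆∣≡1; x∈⁅x⁆; x∈⁅y⁆⇒x≡y; x≢y⇒x∉⁅y⁆;
         x∈p∪q⁺; x∈p∪q⁻)
open import Data.Integer using (ℤ; 0ℤ; _+_)
open import Data.Integer.Properties using (+-0-isCommutativeMonoid)
open import Data.Irrelevant using ([_])
import Data.List as List
open import Data.List.Membership.Propositional.Properties using (∈-map⁺)
open import Data.List.Membership.Propositional.Properties.WithK using (unique∧set⇒bag)
open import Data.List.Properties using (map-cong; map-∘)
open import Data.List.Relation.Binary.BagAndSetEquality using (∼bag⇒↭)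
open import Data.List.Relation.Binary.Permutation.Propositional using (_↭_; ↭⇒↭ₛ)
open import Data.List.Relation.Binary.Permutation.Propositional.Properties using (map⁺)
open import Data.List.Relation.Binary.Permutation.Setoid.Properties using (foldr-commMonoid)
import Data.List.Relation.Unary.Unique.Propositional.Properties as Unique
open import Data.Nat using (ℕ; suc; _≤_)
open import Data.Nat.Properties using (≤-reflexive; ≤-trans; <⇒≱; <⇒≤)
open import Data.Product using (_×_; _,_; proj₁; proj₂)
open import Data.Refinement using (_,_)
open import Data.Sum using (inj₁; inj₂)
open import Data.Vec using (_∷_; here; there)
open import Data.Vec.Properties using (tabulate-cong; ≡-dec)
open import Function using (_∘_; mk⇔)
open import Function.Definitions using (Injective; StrictlySurjective)
open import Relation.Binary.PropositionalEquality
  using (_≡_; _≢_; refl; sym; trans; cong; setoid; module ≡-Reasoning)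
open import Relation.Nullary using (yes; no; contradiction; recompute)
open import Relation.Nullary.Decidable using (decidable-stable; _⊎-dec_)
open import Relation.Unary using (Decidable)

open Finite

private
  variable
    A B : Set
    n   : ℕ

module _ (finA : Finite A) (finB : Finite B) {f : A → B}
         (f-inj : Injective _≡_ _≡_ f) (f-surj : StrictlySurjective _≡_ f) where

  -- Injectivity keeps the mapped list free of duplicates and surjectivity makes it exhaustive.
  -- Duplicate-free lists with the same members are equal as bags, hence permutations of each other.
  map-elements-↭ : List.map f (elements finA) ↭ elements finB
  map-elements-↭ = ∼bag⇒↭ (unique∧set⇒bag (Unique.map⁺ f-inj (unique finA)) (unique finB)
    λ {b} → mk⇔ (λ _ → complete finB b) (λ _ → attained b))
    where
    attained : ∀ b → _
    attained b with f-surj b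
    ... | a , refl = ∈-map⁺ f (complete finA a)

  -- Integer addition is commutative and associative, so the fold is blind to the order in which the
  -- two enumerations list corresponding terms.
  ∑-reindex : {g : A → ℤ} {h : B → ℤ} → (∀ a → g a ≡ h (f a)) → ∑ finA g ≡ ∑ finB h
  ∑-reindex {g} {h} g≗h∘f = begin
    sum (List.map g as)              ≡⟨ cong sum (map-cong g≗h∘f as) ⟩
    sum (List.map (h ∘ f) as)        ≡⟨ cong sum (map-∘ as) ⟩
    sum (List.map h (List.map f as)) ≡⟨ foldr-commMonoid (setoid ℤ) +-0-isCommutativeMonoid
                                          (↭⇒↭ₛ (map⁺ h map-elements-↭)) ⟩
    sum (List.map h (elements finB)) ∎
    where
    open ≡-Reasoning
    as  = elements finA
    sum = List.foldr _+_ 0ℤ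

∣⁅x⁆∪p∣≡1+∣p∣ : {x : Fin n} {p : Subset n} → x ∉ p → ∣ ⁅ x ⁆ ∪ p ∣ ≡ suc ∣ p ∣
∣⁅x⁆∪p∣≡1+∣p∣ {x = zero}  {inside  ∷ p} x∉p = contradiction here x∉p
∣⁅x⁆∪p∣≡1+∣p∣ {x = zero}  {outside ∷ p} x∉p = cong (suc ∘ ∣_∣) (∪-identityˡ p)
∣⁅x⁆∪p∣≡1+∣p∣ {x = suc x} {inside  ∷ p} x∉p = cong suc (∣⁅x⁆∪p∣≡1+∣p∣ (x∉p ∘ there))
∣⁅x⁆∪p∣≡1+∣p∣ {x = suc x} {outside ∷ p} x∉p = ∣⁅x⁆∪p∣≡1+∣p∣ (x∉p ∘ there)

-- An element of `q` outside `p` would make the inclusion strict and so force `∣ p ∣ < ∣ q ∣`.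
p⊆q∧∣q∣≤∣p∣⇒p≡q : {p q : Subset n} → p ⊆ q → ∣ q ∣ ≤ ∣ p ∣ → p ≡ q
p⊆q∧∣q∣≤∣p∣⇒p≡q {p = p} p⊆q ∣q∣≤∣p∣ = ⊆-antisym p⊆q λ {x} x∈q →
  decidable-stable (x ∈? p) λ x∉p →
    <⇒≱ (p⊂q⇒∣p∣<∣q∣ (p⊆q , x , x∈q , x∉p)) ∣q∣≤∣p∣

pair : Fin n → Fin n → Subset n
pair i j = ⁅ i ⁆ ∪ ⁅ j ⁆

module _ {i j : Fin n} where

  i∈pair : i ∈ pair i j
  i∈pair = x∈p∪q⁺ (inj₁ (x∈⁅x⁆ i))

  j∈pair : j ∈ pair i j
  j∈pair = x∈p∪q⁺ (inj₂ (x∈⁅x⁆ j))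

  pair⊆ : ∀ {f} → i ∈ f → j ∈ f → pair i j ⊆ f
  pair⊆ i∈f j∈f x∈pair with x∈p∪q⁻ ⁅ i ⁆ ⁅ j ⁆ x∈pair
  ... | inj₁ x∈⁅i⁆ rewrite x∈⁅y⁆⇒x≡y i x∈⁅i⁆ = i∈f
  ... | inj₂ x∈⁅j⁆ rewrite x∈⁅y⁆⇒x≡y j x∈⁅j⁆ = j∈f

  module _ (i≢j : i ≢ j) where

    ∣pair∣≡2 : ∣ pair i j ∣ ≡ 2
    ∣pair∣≡2 = trans (∣⁅x⁆∪p∣≡1+∣p∣ (x≢y⇒x∉⁅y⁆ i≢j)) (cong suc (∣⁅x⁆∣≡1 j))

    pair-unique : ∀ {f} → ∣ f ∣ ≤ 2 → i ∈ f → j ∈ f → pair i j ≡ f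
    pair-unique ∣f∣≤2 i∈f j∈f = p⊆q∧∣q∣≤∣p∣⇒p≡q (pair⊆ i∈f j∈f)
      (≤-trans ∣f∣≤2 (≤-reflexive (sym ∣pair∣≡2)))

-- Treats both 2-sections at once. That `P` admits every pair inside `e` makes `restrict` well
-- defined; that it admits nothing with more than two vertices makes `restrict` surjective.
module _ {P : Subset n → Subset n → Set} (P? : ∀ e → Decidable (P e))
         (P⇒⊆ : ∀ {e f} → P e f → f ⊆ e)
         (PairIn⇒P : ∀ {e f} → PairIn e f → P e f)
         (P⇒∣∣≤2 : ∀ {e f} → P e f → ∣ f ∣ ≤ 2)
         (G : OrientedHypergraph n) where

  open OrientedHypergraph G

  private
    S : OrientedHypergraph n
    S = subedges P P? P⇒⊆ G

  module _ {i j : Fin n} (i≢j : i ≢ j) where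

    restrict : EdgesContaining G i j → EdgesContaining S i j
    restrict (ι , [ ij∈e ]) =
      (ι , pair i j , [ PairIn⇒P (∣pair∣≡2 i≢j , pair⊆ (proj₁ ij∈e) (proj₂ ij∈e)) ]) ,
      [ i∈pair , j∈pair ]

    -- The index `ι` survives in the image, and the membership proofs are irrelevant.
    restrict-injective : Injective _≡_ _≡_ restrict
    restrict-injective {_ , [ _ ]} {_ , [ _ ]} refl = refl

    restrict-surjective : StrictlySurjective _≡_ restrict
    restrict-surjective ((ι , f , [ p ]) , [ ij∈f ])
      -- The size bound and the memberships are available only irrelevantly, and so is the equation
      -- that `pair-unique` draws from them. Decidable equality of subsets recomputes one that can
      -- be matched on.
      with refl ← recompute (≡-dec _≟ᵇ_ (pair i j) f)
                    (pair-unique i≢j (P⇒∣∣≤2 p) (proj₁ ij∈f) (proj₂ ij∈f))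
      = (ι , [ P⇒⊆ p (proj₁ ij∈f) , P⇒⊆ p (proj₂ ij∈f) ]) , refl

  subedges-adjacencyEntry : ∀ i j → adjacencyEntry G i j ≡ adjacencyEntry S i j
  subedges-adjacencyEntry i j with i ≟ j
  ... | yes _  = refl
  -- Edges of `S` inherit their signs from the same `ι`, and `σ` ignores membership proofs, so the
  -- summands agree by computation.
  ... | no i≢j = ∑-reindex (EdgesContaining-finite G i j) (EdgesContaining-finite S i j)
                   (restrict-injective i≢j) (restrict-surjective i≢j) λ _ → refl

  subedges-adjacencyMatrix : adjacencyMatrix G ≡ adjacencyMatrix S
  subedges-adjacencyMatrix =
    tabulate-cong λ i → tabulate-cong λ j → subedges-adjacencyEntry i j

strict2Section-adjacencyMatrix : (G : OrientedHypergraph n) →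
  adjacencyMatrix G ≡ adjacencyMatrix (strict2Section G)
strict2Section-adjacencyMatrix =
  subedges-adjacencyMatrix PairIn? proj₂ (λ p → p) (≤-reflexive ∘ proj₁)

2Section-adjacencyMatrix : (G : OrientedHypergraph n) →
  adjacencyMatrix G ≡ adjacencyMatrix (2Section G)
2Section-adjacencyMatrix =
  subedges-adjacencyMatrix (λ e f → PairIn? e f ⊎-dec SmallEdge? e f)
    -- This is a different function from the one inside `2Section`, but it enters `σ` only through
    -- an irrelevant argument, so the two hypergraphs agree definitionally.
    (λ { (inj₁ (_ , f⊆e)) → f⊆e ; (inj₂ (_ , refl)) → λ x∈f → x∈f })
    -- A small edge cannot contain two distinct vertices, so it contributes to no off-diagonal
    -- entry; the common bound of two covers it.
    inj₁ λ { (inj₁ (∣f∣≡2 , _)) → ≤-reflexive ∣f∣≡2 ; (inj₂ (∣f∣<2 , _)) → <⇒≤ ∣f∣<2 }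

theorem4p1 : (n : ℕ) (G : OrientedHypergraph n) →
    (adjacencyMatrix G ≡ adjacencyMatrix (strict2Section G)) ×
    (adjacencyMatrix (strict2Section G) ≡ adjacencyMatrix (2Section G))
theorem4p1 n G =
  strict2Section-adjacencyMatrix G ,
  trans (sym (strict2Section-adjacencyMatrix G)) (2Section-adjacencyMatrix G)
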